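{- An element $x$ of an algebraic dcpo $D$ is sharp if and only if for every compact $c\in D$ it is decidable whether $c\sqsubseteq x$ holds.
   Context: Everything is constructive: neither excluded middle nor choice is assumed. A proposition $P$ is decidable if $P\vee\lnot P$ holds. A subset $S$ of a poset is directed if it is inhabited and any two elements of $S$ have an upper bound in $S$. A dcpo is a poset $(D,\sqsubseteq)$ in which every directed subset $S$ has a supremum $\bigsqcup S$. Write $x\ll y$ ($x$ is way below $y$) if for every directed $S$ with $y\sqsubseteq\bigsqcup S$ there is $s\in S$ with $x\sqsubseteq s$. An element $c$ is compact if $c\ll c$. $D$ is algebraic if for every $x\in D$ the set $\{c\in D\mid c\sqsubseteq x,\ c\text{ compact}\}$ is directed with supremum $x$. An element $x\in D$ is sharp if for every $y,z\in D$ with $y\ll z$ we have $y\ll x$ or $\lnot(z\sqsubseteq x)$. -}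

module Defs where

open import Level using (Level; _⊔_; suc)
open import Data.Product using (_×_; ∃-syntax; Σ-syntax)
open import Data.Sum using (_⊎_)
open import Relation.Binary.Bundles using (Poset)
open import Relation.Nullary using (¬_)
open import Relation.Unary using (Pred; _∈_; _≐_; Satisfiable)

-- A subset is a predicate.  Predicates on a setoid are not required to respect
-- _≈_: closing S under _≈_ changes neither directedness, nor suprema, nor
-- whether some element of S lies above a given x.
module _ {c ℓ₁ ℓ₂ : Level} (P : Poset c ℓ₁ ℓ₂) where
  open Poset P using (Carrier) renaming (_≤_ to _⊑_)

  IsDirected : {s : Level} → Pred Carrier s → Set (c ⊔ ℓ₂ ⊔ s)
  IsDirected S =
    Satisfiable S ×
    (∀ {a b} → a ∈ S → b ∈ S → ∃[ d ] (d ∈ S × a ⊑ d × b ⊑ d))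

  IsUpperBound : {s : Level} → Pred Carrier s → Carrier → Set (c ⊔ ℓ₂ ⊔ s)
  IsUpperBound S u = ∀ {a} → a ∈ S → a ⊑ u

  IsSupremum : {s : Level} → Pred Carrier s → Carrier → Set (c ⊔ ℓ₂ ⊔ s)
  IsSupremum S u = IsUpperBound S u × (∀ v → IsUpperBound S v → u ⊑ v)

-- Agda's universes are predicative, so the level p of the subsets in play is a
-- parameter of the structure.
record DCPO (c ℓ₁ ℓ₂ p : Level) : Set (suc (c ⊔ ℓ₁ ⊔ ℓ₂ ⊔ p)) where
  field
    poset : Poset c ℓ₁ ℓ₂

  open Poset poset public renaming (_≤_ to _⊑_)

  field
    ⨆           : (S : Pred Carrier p) → IsDirected poset S → Carrier
    ⨆-supremum  : (S : Pred Carrier p) (δ : IsDirected poset S) →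
                  IsSupremum poset S (⨆ S δ)

module _ {c ℓ₁ ℓ₂ p : Level} (D : DCPO c ℓ₁ ℓ₂ p) where
  open DCPO D

  WayBelow : Carrier → Carrier → Set (c ⊔ ℓ₂ ⊔ suc p)
  WayBelow x y =
    (S : Pred Carrier p) (δ : IsDirected poset S) →
    y ⊑ ⨆ S δ → ∃[ s ] (s ∈ S × x ⊑ s)

  IsCompact : Carrier → Set (c ⊔ ℓ₂ ⊔ suc p)
  IsCompact k = WayBelow k k

  CompactsBelow : Carrier → Pred Carrier (c ⊔ ℓ₂ ⊔ suc p)
  CompactsBelow x k = k ⊑ x × IsCompact k

  -- CompactsBelow x quantifies over all level-p predicates, hence is not itself
  -- a level-p predicate.  That {k | k ⊑ x, k compact} is a subset in the same
  -- sense as those in the definition of DCPO, which is automatic in an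
  -- impredicative setting, is expressed by a level-p predicate with the same
  -- elements.
  IsAlgebraic : Set (c ⊔ ℓ₂ ⊔ suc p)
  IsAlgebraic =
    ∀ x → Σ[ K ∈ Pred Carrier p ]
      (K ≐ CompactsBelow x × IsDirected poset K × IsSupremum poset K x)

  IsSharp : Carrier → Set (c ⊔ ℓ₂ ⊔ suc p)
  IsSharp x = ∀ y z → WayBelow y z → WayBelow y x ⊎ ¬ (z ⊑ x)

{-# OPTIONS --safe #-}
-- In an algebraic dcpo, y ≪ z holds exactly when some compact k satisfies
-- y ⊑ k ⊑ z.  Sharpness at k ≪ k thus decides k ⊑ x, and conversely deciding
-- k ⊑ x for a k interpolating y ≪ z yields y ≪ x or refutes z ⊑ x.
module Submission where

open import Defs
open import Level using (Level)
open import Data.Product using (_×_; _,_; proj₁; ∃-syntax)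
open import Data.Sum using (inj₁; inj₂; [_,_]′)
open import Function.Base using (_∘_)
open import Function.Bundles using (_⇔_; mk⇔)
open import Relation.Nullary using (Dec; yes; no)

module _ {c ℓ₁ ℓ₂ p : Level} (D : DCPO c ℓ₁ ℓ₂ p) where
  open DCPO D

  ⊑-≪-⊑-trans : ∀ {w x y z} → w ⊑ x → WayBelow D x y → y ⊑ z → WayBelow D w z
  ⊑-≪-⊑-trans w⊑x x≪y y⊑z S δ z⊑⨆S =
    let s , s∈S , x⊑s = x≪y S δ (trans y⊑z z⊑⨆S)
    in  s , s∈S , trans w⊑x x⊑s

  -- The compacts below `z` form a directed set with supremum `z`, so `y ≪ z` can be tested against
  -- that set.
  compact-interpolation : IsAlgebraic D → ∀ {y z} → WayBelow D y z →
                          ∃[ k ] (IsCompact D k × y ⊑ k × k ⊑ z)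
  compact-interpolation alg {z = z} y≪z =
    let K , (K⊆ , _) , δ , (_ , z-least) = alg z
        -- `z` is a least upper bound of `K`, hence below the chosen one `⨆ K δ`.
        k , k∈K , y⊑k = y≪z K δ (z-least (⨆ K δ) (proj₁ (⨆-supremum K δ)))
        k⊑z , k-compact = K⊆ k∈K
    in  k , k-compact , y⊑k , k⊑z

  -- The singleton `_≈ z` lives at level `ℓ₁` rather than `p`, so the usual test against it is
  -- replaced by an interpolating compact.
  ≪⇒⊑ : IsAlgebraic D → ∀ {y z} → WayBelow D y z → y ⊑ z
  ≪⇒⊑ alg y≪z =
    let _ , _ , y⊑k , k⊑z = compact-interpolation alg y≪z
    in  trans y⊑k k⊑z

  sharp⇒compacts-decidable : IsAlgebraic D → ∀ {x} → IsSharp D x →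
                             ∀ k → IsCompact D k → Dec (k ⊑ x)
  sharp⇒compacts-decidable alg sharp k k≪k =
    [ yes ∘ ≪⇒⊑ alg , no ]′ (sharp k k k≪k)

  compacts-decidable⇒sharp : IsAlgebraic D → ∀ {x} →
                             (∀ k → IsCompact D k → Dec (k ⊑ x)) → IsSharp D x
  compacts-decidable⇒sharp alg dec y z y≪z
    with k , k≪k , y⊑k , k⊑z ← compact-interpolation alg y≪z
    with dec k k≪k
  -- Compactness supplies the strict middle link in `y ⊑ k ≪ k ⊑ x`.
  ... | yes k⊑x = inj₁ (⊑-≪-⊑-trans y⊑k k≪k k⊑x)
  ... | no  k⋢x = inj₂ (k⋢x ∘ trans k⊑z)

proposition5p11 : {c ℓ₁ ℓ₂ p : Level} (D : DCPO c ℓ₁ ℓ₂ p) → IsAlgebraic D →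
    (x : DCPO.Carrier D) →
    IsSharp D x ⇔
    ((k : DCPO.Carrier D) → IsCompact D k → Dec (DCPO._⊑_ D k x))
proposition5p11 D alg x =
  mk⇔ (sharp⇒compacts-decidable D alg) (compacts-decidable⇒sharp D alg)
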